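{- Let $k\ge 3$ be a fixed integer. Let $T(n,k)$ be the number of onto functions $f:[n]\to[k]$ with $|f^{ -1}(\{1\})|<|f^{ -1}(\{2\})|<\cdots<|f^{ -1}(\{k\})|$, and let $U(n,k)$ be the number of onto functions $f:[n]\to[k]$ with $|f^{ -1}(\{1\})|\le|f^{ -1}(\{2\})|\le\cdots\le|f^{ -1}(\{k\})|$. Then $$\lim_{n\to\infty}\frac{T(n,k)}{S(n,k)}=1\qquad\text{and}\qquad \lim_{n\to\infty}\frac{U(n,k)}{S(n,k)}=1 .$$
   Context: $[m]=\{1,2,\dots,m\}$. $S(n,k)$ is the Stirling number of the second kind, the number of partitions of $[n]$ into $k$ nonempty parts. For $n\ge\frac{(k+4)(k-1)}{2}+1$, $T(n,k)$ is the length of a universal cycle of all onto functions $[n]\to[k]$ with strictly increasing preimage sizes (a universal packing of the partitions of $[n]$ into $k$ parts), and $U(n,k)$ is the length of a universal cycle of all onto functions $[n]\to[k]$ with non-decreasing preimage sizes (a universal covering of these partitions); the length of a universal cycle of a set of strings equals the number of strings in the set. -}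

module Defs where

open import Data.Fin.Base as Fin using (Fin; finToFun)
open import Data.Fin.Properties as Fin using (all?; any?)
open import Data.Fin.Subset
  using (Subset; inside; outside; _∈_; _∩_; Empty; Nonempty; ∣_∣)
open import Data.Fin.Subset.Properties using (_∈?_; nonempty?)
open import Data.Integer.Base using (+_)
open import Data.List.Base as List
  using (List; []; _∷_; [_]; _++_; map; filter; length; allFin)
open import Data.List.Relation.Unary.All as All using (All)
open import Data.List.Relation.Unary.AllPairs as AllPairs using (AllPairs)
open import Data.List.Relation.Unary.Any as Any using (Any)
open import Data.Nat.Base as ℕ using (ℕ; zero; suc)
import Data.Nat.Properties as ℕ
open import Data.Product.Base using (∃; _×_)
open import Data.Rational.Base as ℚ using (ℚ; 0ℚ)
open import Data.Vec.Base as Vec using (tabulate)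
open import Function.Definitions using (StrictlySurjective)
open import Relation.Binary.Core using (Rel)
open import Relation.Binary.Definitions using () renaming (Decidable to Decidable₂)
open import Relation.Binary.PropositionalEquality.Core using (_≡_)
open import Relation.Nullary.Decidable using (Dec; does; ¬?; _×-dec_; _→-dec_)
open import Relation.Unary using (Pred; Decidable)

private
  variable
    A : Set
    k n : ℕ

infix  4 _⟶_
infixl 7 _÷_

-- [m] is represented by Fin m, with i standing for toℕ i + 1.

Onto : (Fin n → Fin k) → Set
Onto = StrictlySurjective _≡_

onto? : (f : Fin n → Fin k) → Dec (Onto f)
onto? f = all? λ y → any? λ x → f x Fin.≟ y

preimage : (Fin n → Fin k) → Fin k → Subset n
preimage f i = tabulate λ x → does (f x Fin.≟ i)

-- For transitive _~_ this is the chain |f⁻¹(1)| ~ |f⁻¹(2)| ~ ⋯ ~ |f⁻¹(k)|.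
PreimageSizes : Rel ℕ _ → (Fin n → Fin k) → Set
PreimageSizes _~_ f =
  ∀ i j → i Fin.< j → ∣ preimage f i ∣ ~ ∣ preimage f j ∣

preimageSizes? : {_~_ : Rel ℕ _} → Decidable₂ _~_ →
                 (f : Fin n → Fin k) → Dec (PreimageSizes _~_ f)
preimageSizes? _~?_ f = all? λ i → all? λ j →
  (i Fin.<? j) →-dec (∣ preimage f i ∣ ~? ∣ preimage f j ∣)

-- The bijection finToFun lists every function exactly once up to pointwise
-- equality.
functions : ∀ n k → List (Fin n → Fin k)
functions n k = map finToFun (allFin (k ℕ.^ n))

T : ℕ → ℕ → ℕ
T n k = length (filter (λ f → onto? f ×-dec preimageSizes? ℕ._<?_ f) (functions n k))

U : ℕ → ℕ → ℕ
U n k = length (filter (λ f → onto? f ×-dec preimageSizes? ℕ._≤?_ f) (functions n k))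

subsets : ∀ n → List (Subset n)
subsets zero    = [ Vec.[] ]
subsets (suc n) = map (outside Vec.∷_) (subsets n) ++ map (inside Vec.∷_) (subsets n)

-- All sublists of length k.  When xs has no repetitions, these are the
-- k-element sets of entries of xs, each listed once.
choose : ℕ → List A → List (List A)
choose zero    xs       = [ [] ]
choose (suc k) []       = []
choose (suc k) (x ∷ xs) = map (x ∷_) (choose k xs) ++ choose (suc k) xs

Disjoint : Rel (Subset n) _
Disjoint p q = Empty (p ∩ q)

IsPartition : Pred (List (Subset n)) _
IsPartition bs =
  All Nonempty bs × AllPairs Disjoint bs × (∀ x → Any (x ∈_) bs)

isPartition? : Decidable (IsPartition {n})
isPartition? bs =
  All.all? nonempty? bs
  ×-dec AllPairs.allPairs? (λ p q → ¬? (nonempty? (p ∩ q))) bs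
  ×-dec all? (λ x → Any.any? (x ∈?_) bs)

-- Stirling numbers of the second kind.
S : ℕ → ℕ → ℕ
S n k = length (filter isPartition? (choose k (subsets n)))

-- The quotient is 0 when the denominator is 0.  As S n k > 0 whenever
-- 1 ≤ k ≤ n, limits of ratios with denominator S n k do not depend on this.
_÷_ : ℕ → ℕ → ℚ
a ÷ zero      = 0ℚ
a ÷ b@(suc _) = (+ a) ℚ./ b

-- Convergence of a rational sequence to a rational limit; letting ε range
-- over the positive rationals is equivalent to letting it range over the
-- positive reals.
_⟶_ : (ℕ → ℚ) → ℚ → Set
a ⟶ l = ∀ ε → 0ℚ ℚ.< ε → ∃ λ N → ∀ n → N ℕ.≤ n → ℚ.∣ a n ℚ.- l ∣ ℚ.< ε

{-# OPTIONS --safe #-}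

-- Call a function [n] → [k] tied if two of its preimages have equal sizes, and
-- let B be the number of tied functions.  A partition with distinct block sizes
-- has exactly one labelling with increasing sizes, so T ≤ S ≤ T + B, and
-- T ≤ U ≤ T + B is clear; hence |T - S| and |U - S| are at most B.  An onto
-- function is a partition with a labelling of its blocks, so S is at least the
-- number of onto functions divided by kᵏ.  It remains to see that tied and
-- non-onto functions are rare among all kⁿ functions.
--
-- For fixed i ≠ j, group the functions by the number m of arguments sent to
-- {i , j}: the number with |f⁻¹(i)| = |f⁻¹(j)| is Σₘ C(n,m) (k-2)ⁿ⁻ᵐ c(m), where
-- c(m) is C(m,m/2) or 0, and c(m)² (m + 1) ≤ 4ᵐ.  By AM-GM,
-- 2 L (m + 1) c(m) ≤ 2ᵐ (m + 1 + L²) for every L, and since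
-- (n + 1) C(n,m) = (m + 1) C(n+1,m+1), summation gives
-- 2 L (n + 1) Σ ≤ (n + 1) kⁿ + L² kⁿ⁺¹, that is L Σ ≤ kⁿ as soon as n + 1 ≥ L² k.
-- Functions with |f⁻¹(i)| = 0 are counted in the same way with c(m) = 1.

module Submission where

open import Defs
open import Data.Nat.Base using (ℕ; _≤_)
open import Data.Product.Base using (_×_)
open import Data.Rational.Base using (1ℚ)
open import Data.Bool.Base as Bool using (if_then_else_)
import Data.Bool.Properties as Bool
open import Data.Empty using (⊥; ⊥-elim)
open import Data.Fin.Base as Fin using (Fin; zero; suc; toℕ; finToFun; funToFin)
import Data.Fin.Properties as Fin
open import Data.Fin.Subset using (Subset; inside; outside; _∈_; Nonempty; ∣_∣)
open import Data.Fin.Subset.Properties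
  using (⊆-antisym; ∈⊤; ∣⊤∣≡n; ∣⊥∣≡0; Empty-unique; p⊂q⇒∣p∣<∣q∣; x∈p∩q⁻; x∈p∩q⁺)
open import Data.Integer.Base as ℤ using (+[1+_]; -[1+_])
import Data.Integer.Properties as ℤ
open import Data.List.Base as List
  using (List; []; _∷_; map; filter; length; allFin; lookup; cartesianProduct; cartesianProductWith)
import Data.List.Properties as List
open import Data.List.Membership.Propositional using (lose) renaming (_∈_ to _∈ˡ_)
import Data.List.Membership.Propositional.Properties as List
open import Data.List.Relation.Unary.All as All using (All; []; _∷_)
import Data.List.Relation.Unary.All.Properties as All
open import Data.List.Relation.Unary.AllPairs as AllPairs using (AllPairs; []; _∷_)
import Data.List.Relation.Unary.AllPairs.Properties as AllPairs
open import Data.List.Relation.Unary.Any as Any using (Any; here; there; _─_; index)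
import Data.List.Relation.Unary.Any.Properties as Any
open import Data.List.Relation.Unary.Unique.Propositional using (Unique)
import Data.List.Relation.Unary.Unique.Propositional.Properties as Unique
open import Data.Nat.Base as ℕ using (zero; suc; _+_; _*_; _^_; _<_; s≤s; z≤n)
import Data.Nat.ListAction as ListAction
import Data.Nat.ListAction.Properties as ListAction
import Data.Nat.Properties as ℕ
open import Data.Nat.Tactic.RingSolver using (solve-∀)
open import Data.Product.Base using (∃; ∃₂; _,_; proj₁; proj₂)
open import Data.Rational.Base as ℚ using (mkℚ; 0ℚ; toℚᵘ)
import Data.Rational.Properties as ℚ
open import Data.Rational.Unnormalised.Base as ℚᵘ using (mkℚᵘ)
import Data.Rational.Unnormalised.Properties as ℚᵘ
open import Data.Sum.Base using (_⊎_; inj₁; inj₂; [_,_]′)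
open import Data.Unit.Base using (⊤)
open import Data.Vec.Base as Vec using (Vec)
open import Data.Vec.Functional using (removeAt)
import Data.Vec.Properties as Vec
open import Function.Base using (_∘_; id; case_of_)
open import Level using (0ℓ)
open import Relation.Binary.Core using (REL; Rel)
open import Relation.Binary.Definitions using (tri<; tri≈; tri>) renaming (Decidable to Decidable₂)
open import Relation.Binary.PropositionalEquality
  using (_≡_; _≢_; _≗_; refl; sym; trans; cong; cong₂; subst; subst₂; ≢-sym; module ≡-Reasoning)
open import Relation.Nullary using (¬_; Dec; yes; no; does)
open import Relation.Nullary.Decidable using (toSum; _×-dec_; ¬?; dec-true; dec-false)
open import Relation.Unary using (Pred; Decidable)
open import Algebra.Properties.CommutativeMonoid.Sum ℕ.+-0-commutativeMonoid using (sum; sum-remove)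

private
  variable
    A B : Set
    k n : ℕ

-- Counting by injections

Any-─ : {P Q : Pred A 0ℓ} {xs : List A} (p : Any P xs) → Any Q xs →
        (∀ {x} → P x → ¬ Q x) → Any Q (xs ─ p)
Any-─ (here px) (here qx) ¬pq = ⊥-elim (¬pq px qx)
Any-─ (here px) (there q) ¬pq = q
Any-─ (there p) (here qx) ¬pq = here qx
Any-─ (there p) (there q) ¬pq = there (Any-─ p q ¬pq)

-- The pigeonhole principle, with a relation `R` in place of an injection and `D` in place of
-- inequality, so that functions may be distinguished pointwise. The partner of the head is deleted
-- from `ys`. By the last hypothesis no later entry is related to it, so all other partners survive.
length-≤ : {D : Rel A 0ℓ} {R : REL A B 0ℓ} {xs : List A} {ys : List B} →
           AllPairs D xs → All (λ x → Any (R x) ys) xs →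
           (∀ {x x′ y} → R x y → R x′ y → ¬ D x x′) → length xs ≤ length ys
length-≤ []       []       inj = z≤n
length-≤ {ys = ys} (d ∷ ds) (p ∷ ps) inj = begin
  suc _                 ≤⟨ s≤s (length-≤ ds
    (All.zipWith (λ (dx , q) → Any-─ p q λ r r′ → inj r r′ dx) (d , ps)) inj) ⟩
  suc (length (ys ─ p)) ≡⟨ List.length-removeAt′ ys (index p) ⟨
  length ys             ∎
  where open ℕ.≤-Reasoning

length-filter-⊆ : {P Q : Pred A 0ℓ} (P? : Decidable P) (Q? : Decidable Q) →
                  (∀ {x} → P x → Q x) → ∀ xs → length (filter P? xs) ≤ length (filter Q? xs)
length-filter-⊆ P? Q? P⊆Q []       = z≤n
length-filter-⊆ P? Q? P⊆Q (x ∷ xs) with ih ← length-filter-⊆ P? Q? P⊆Q xs | P? x | Q? x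
... | no _  | no _  = ih
... | no _  | yes _ = ℕ.m≤n⇒m≤1+n ih
... | yes p | no ¬q = ⊥-elim (¬q (P⊆Q p))
... | yes _ | yes _ = s≤s ih

length-filter-⊎ : {P Q R : Pred A 0ℓ} (P? : Decidable P) (Q? : Decidable Q) (R? : Decidable R) →
                  (∀ {x} → P x → Q x ⊎ R x) → ∀ xs →
                  length (filter P? xs) ≤ length (filter Q? xs) + length (filter R? xs)
length-filter-⊎ P? Q? R? split [] = z≤n
length-filter-⊎ P? Q? R? split (x ∷ xs)
  with ih ← length-filter-⊎ P? Q? R? split xs | P? x | Q? x | R? x
... | no _  | no _  | no _  = ih
... | no _  | no _  | yes _ = ℕ.≤-trans ih (ℕ.+-monoʳ-≤ _ (ℕ.n≤1+n _))
... | no _  | yes _ | no _  = ℕ.m≤n⇒m≤1+n ih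
... | no _  | yes _ | yes _ = ℕ.m≤n⇒m≤1+n (ℕ.≤-trans ih (ℕ.+-monoʳ-≤ _ (ℕ.n≤1+n _)))
... | yes p | no ¬q | no ¬r = ⊥-elim ([ ¬q , ¬r ]′ (split p))
... | yes _ | no _  | yes _ = ℕ.≤-trans (s≤s ih) (ℕ.≤-reflexive (sym (ℕ.+-suc _ _)))
... | yes _ | yes _ | no _  = s≤s ih
... | yes _ | yes _ | yes _ = s≤s (ℕ.≤-trans ih (ℕ.+-monoʳ-≤ _ (ℕ.n≤1+n _)))

_≇_ : Rel (Fin n → Fin k) 0ℓ
f ≇ g = ¬ f ≗ g

functions-distinct : ∀ n k → AllPairs _≇_ (functions n k)
functions-distinct n k = AllPairs.map⁺ (AllPairs.map ≢⇒≇ (Unique.allFin⁺ (k ^ n)))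
  where
  funToFin-cong : ∀ {m} {f g : Fin m → Fin k} → f ≗ g → funToFin f ≡ funToFin g
  funToFin-cong {zero}  f≗g = refl
  funToFin-cong {suc m} f≗g = cong₂ Fin.combine (f≗g zero) (funToFin-cong (f≗g ∘ suc))

  ≢⇒≇ : ∀ {i j : Fin (k ^ n)} → i ≢ j → finToFun {k} {n} i ≇ finToFun j
  ≢⇒≇ {i} {j} i≢j f≗g = i≢j (trans (sym (Fin.funToFin-finToFin {n} {k} i))
    (trans (funToFin-cong f≗g) (Fin.funToFin-finToFin {n} {k} j)))

length-functions : ∀ n k → length (functions n k) ≡ k ^ n
length-functions n k = trans (List.length-map (finToFun {k} {n}) (allFin (k ^ n)))
                             (List.length-tabulate {n = k ^ n} id)

-- The list holds only a pointwise copy `finToFun (funToFin f)` of `f`, so `P` has to respect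
-- pointwise equality and membership is stated up to `_≗_`.
∈-functions : {P : Pred (Fin n → Fin k) 0ℓ} (P? : Decidable P) →
              (∀ {f g} → f ≗ g → P f → P g) →
              ∀ {f} → P f → Any (f ≗_) (filter P? (functions n k))
∈-functions {n} {k} P? resp {f} Pf = lose
  (List.∈-filter⁺ P? (List.∈-map⁺ finToFun (List.∈-allFin (funToFin f)))
    (resp (sym ∘ Fin.finToFun-funToFin f) Pf))
  (sym ∘ Fin.finToFun-funToFin f)

-- Preimages

size : (Fin n → Fin k) → Fin k → ℕ
size f i = ∣ preimage f i ∣

x∈preimage⁺ : ∀ (f : Fin n → Fin k) {x i} → f x ≡ i → x ∈ preimage f i
x∈preimage⁺ f {x} {i} fx≡i = Vec.lookup⇒[]= x _
  (trans (Vec.lookup∘tabulate _ x) (dec-true (f x Fin.≟ i) fx≡i))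

x∈preimage⁻ : ∀ (f : Fin n → Fin k) {x i} → x ∈ preimage f i → f x ≡ i
x∈preimage⁻ f {x} {i} x∈
  with trans (sym (Vec.lookup∘tabulate (λ y → does (f y Fin.≟ i)) x)) (Vec.[]=⇒lookup x∈)
... | eq with yes fx≡i ← f x Fin.≟ i = fx≡i

preimage-cong : {f g : Fin n → Fin k} → f ≗ g → ∀ i → preimage f i ≡ preimage g i
preimage-cong f≗g i = Vec.tabulate-cong λ x → cong (λ y → does (y Fin.≟ i)) (f≗g x)

preimages-determine : ∀ {f g : Fin n → Fin k} → (∀ i → preimage f i ≡ preimage g i) → f ≗ g
preimages-determine {f = f} {g} eq x =
  sym (x∈preimage⁻ g (subst (x ∈_) (eq (f x)) (x∈preimage⁺ f refl)))

preimage-injective : ∀ (f : Fin n → Fin k) → Onto f → ∀ {i j} → preimage f i ≡ preimage f j → i ≡ j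
preimage-injective f onto {i} eq with x , fx≡i ← onto i =
  trans (sym fx≡i) (x∈preimage⁻ f (subst (x ∈_) eq (x∈preimage⁺ f fx≡i)))

Onto-resp : ∀ {f g : Fin n → Fin k} → f ≗ g → Onto f → Onto g
Onto-resp f≗g onto y with x , fx≡y ← onto y = x , trans (sym (f≗g x)) fx≡y

PreimageSizes-resp : ∀ {_~_ : Rel ℕ 0ℓ} {f g : Fin n → Fin k} → f ≗ g →
                     PreimageSizes _~_ f → PreimageSizes _~_ g
PreimageSizes-resp {_~_ = _~_} f≗g sizes i j i<j
  rewrite sym (preimage-cong f≗g i) | sym (preimage-cong f≗g j) = sizes i j i<j

-- Partitions as sublists of the list of subsets

∈-subsets : (p : Subset n) → p ∈ˡ subsets n
∈-subsets Vec.[]            = here refl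
∈-subsets (outside Vec.∷ p) = List.∈-++⁺ˡ (List.∈-map⁺ _ (∈-subsets p))
∈-subsets (inside Vec.∷ p)  =
  List.∈-++⁺ʳ (map (outside Vec.∷_) (subsets _)) (List.∈-map⁺ _ (∈-subsets p))

subsets-unique : ∀ n → Unique (subsets n)
subsets-unique zero    = [] ∷ []
subsets-unique (suc n) = Unique.++⁺
  (Unique.map⁺ Vec.∷-injectiveʳ (subsets-unique n))
  (Unique.map⁺ Vec.∷-injectiveʳ (subsets-unique n))
  λ (p∈ , q∈) → case List.∈-map⁻ _ p∈ , List.∈-map⁻ _ q∈ of λ
    { ((_ , _ , refl) , (_ , _ , ())) }

∈-choose⁻ : ∀ k (xs : List A) {ys} → ys ∈ˡ choose k xs → length ys ≡ k × All (_∈ˡ xs) ys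
∈-choose⁻ zero    xs       (here refl) = refl , []
∈-choose⁻ (suc k) (x ∷ xs) ys∈ with List.∈-++⁻ (map (x ∷_) (choose k xs)) ys∈
... | inj₂ ys∈′ with len , ⊆xs ← ∈-choose⁻ (suc k) xs ys∈′ = len , All.map there ⊆xs
... | inj₁ ys∈′ with zs , zs∈ , refl ← List.∈-map⁻ (x ∷_) ys∈′
    with len , ⊆xs ← ∈-choose⁻ k xs zs∈ = cong suc len , here refl ∷ All.map there ⊆xs

choose-unique : ∀ k {xs : List A} → Unique xs → Unique (choose k xs)
choose-unique zero    _          = [] ∷ []
choose-unique (suc k) []         = []
choose-unique (suc k) {x ∷ xs} (x∉ ∷ xs!) = Unique.++⁺
  (Unique.map⁺ List.∷-injectiveʳ (choose-unique k xs!))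
  (choose-unique (suc k) xs!)
  λ (ys∈ , ys∈′) → case List.∈-map⁻ _ ys∈ of λ
    { (_ , _ , refl) → case ∈-choose⁻ (suc k) xs ys∈′ of λ
      { (_ , x∈ ∷ _) → All.lookup x∉ x∈ refl } }

filter∈choose : {P : Pred A 0ℓ} (P? : Decidable P) (xs : List A) →
                filter P? xs ∈ˡ choose (length (filter P? xs)) xs
filter∈choose P? [] = here refl
filter∈choose P? (x ∷ xs) with P? x
... | yes _ = List.∈-++⁺ˡ (List.∈-map⁺ _ (filter∈choose P? xs))
... | no  _ = skip (filter P? xs) (filter∈choose P? xs)
  where
  skip : ∀ ys → ys ∈ˡ choose (length ys) xs → ys ∈ˡ choose (length ys) (x ∷ xs)
  -- `choose` recurses on the length first, so `ys` is split before the extra entry `x` can be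
  -- skipped.
  skip []      ys∈ = here refl
  skip (_ ∷ ys) ys∈ = List.∈-++⁺ʳ (map (x ∷_) (choose (length ys) xs)) ys∈

-- Both lists inherit the order of `xs`, so their elements determine them. If only one of them
-- starts with `x`, then `x` would occur again in the tail of `xs`.
choose-≡ : ∀ k {xs : List A} → Unique xs → ∀ {ys zs} → ys ∈ˡ choose k xs → zs ∈ˡ choose k xs →
           (∀ {x} → x ∈ˡ ys → x ∈ˡ zs) → (∀ {x} → x ∈ˡ zs → x ∈ˡ ys) → ys ≡ zs
choose-≡ zero    _  (here refl) (here refl) _ _ = refl
choose-≡ (suc k) {x ∷ xs} (x∉ ∷ xs!) ys∈ zs∈ ys⊆zs zs⊆ys
  with List.∈-++⁻ (map (x ∷_) (choose k xs)) ys∈ | List.∈-++⁻ (map (x ∷_) (choose k xs)) zs∈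
... | inj₂ ys∈′ | inj₂ zs∈′ = choose-≡ (suc k) xs! ys∈′ zs∈′ ys⊆zs zs⊆ys
... | inj₁ ys∈′ | inj₂ zs∈′ with _ , _ , refl ← List.∈-map⁻ (x ∷_) ys∈′ =
  ⊥-elim (All.lookup x∉ (All.lookup (proj₂ (∈-choose⁻ (suc k) xs zs∈′)) (ys⊆zs (here refl))) refl)
... | inj₂ ys∈′ | inj₁ zs∈′ with _ , _ , refl ← List.∈-map⁻ (x ∷_) zs∈′ =
  ⊥-elim (All.lookup x∉ (All.lookup (proj₂ (∈-choose⁻ (suc k) xs ys∈′)) (zs⊆ys (here refl))) refl)
... | inj₁ ys∈′ | inj₁ zs∈′
    with ys , ys∈″ , refl ← List.∈-map⁻ (x ∷_) ys∈′ | zs , zs∈″ , refl ← List.∈-map⁻ (x ∷_) zs∈′ =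
  cong (x ∷_) (choose-≡ k xs! ys∈″ zs∈″ (restrict ys∈″ ys⊆zs) (restrict zs∈″ zs⊆ys))
  where
  restrict : ∀ {us vs} → us ∈ˡ choose k xs → (∀ {y} → y ∈ˡ x ∷ us → y ∈ˡ x ∷ vs) →
             ∀ {y} → y ∈ˡ us → y ∈ˡ vs
  restrict us∈ us⊆vs y∈ with us⊆vs (there y∈)
  ... | here refl = ⊥-elim (All.lookup x∉ (All.lookup (proj₂ (∈-choose⁻ k xs us∈)) y∈) refl)
  ... | there y∈′ = y∈′

isBlock? : (f : Fin n → Fin k) (p : Subset n) → Dec (∃ λ i → p ≡ preimage f i)
isBlock? f p = Fin.any? λ i → Vec.≡-dec Bool._≟_ p (preimage f i)

-- Filtering `subsets n`, rather than listing the preimages, forgets the labels and fixes an order.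
-- Functions with the same set of preimages thus get propositionally equal lists of blocks.
blocks : (Fin n → Fin k) → List (Subset n)
blocks {n} f = filter (isBlock? f) (subsets n)

preimage∈blocks : (f : Fin n → Fin k) (i : Fin k) → preimage f i ∈ˡ blocks f
preimage∈blocks f i = List.∈-filter⁺ (isBlock? f) (∈-subsets _) (i , refl)

∈-blocks⁻ : (f : Fin n → Fin k) {p : Subset n} → p ∈ˡ blocks f → ∃ λ i → p ≡ preimage f i
∈-blocks⁻ {n} f p∈ = proj₂ (List.∈-filter⁻ (isBlock? f) {xs = subsets n} p∈)

blocks-unique : (f : Fin n → Fin k) → Unique (blocks f)
blocks-unique {n} f = Unique.filter⁺ (isBlock? f) (subsets-unique n)

-- Two injections: a block goes to a label of it, a label to its preimage. The second is injective
-- because `f` is onto, which makes preimages nonempty.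
length-blocks : (f : Fin n → Fin k) → Onto f → length (blocks f) ≡ k
length-blocks {k = k} f onto = ℕ.≤-antisym
  (subst (length (blocks f) ≤_) (List.length-tabulate id)
    (length-≤ {R = λ p i → p ≡ preimage f i} (blocks-unique f)
    (All.tabulate λ p∈ → lose (List.∈-allFin (proj₁ (∈-blocks⁻ f p∈))) (proj₂ (∈-blocks⁻ f p∈)))
    λ p≡ q≡ p≢q → p≢q (trans p≡ (sym q≡))))
  (subst (_≤ length (blocks f)) (List.length-tabulate id)
    (length-≤ {R = λ i p → preimage f i ≡ p} (Unique.allFin⁺ k)
    (All.universal (λ i → lose (preimage∈blocks f i) refl) _)
    λ i≡ j≡ i≢j → i≢j (preimage-injective f onto (trans i≡ (sym j≡)))))

blocks∈choose : (f : Fin n → Fin k) → Onto f → blocks f ∈ˡ choose k (subsets n)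
blocks∈choose {n} f onto = subst (λ l → blocks f ∈ˡ choose l (subsets n)) (length-blocks f onto)
  (filter∈choose (isBlock? f) (subsets n))

mapAllPairs∈ : {R Q : Rel A 0ℓ} {xs : List A} → (∀ {x y} → x ∈ˡ xs → y ∈ˡ xs → R x y → Q x y) →
               AllPairs R xs → AllPairs Q xs
mapAllPairs∈ f []       = []
mapAllPairs∈ f (r ∷ rs) =
  All.tabulate (λ y∈ → f (here refl) (there y∈) (All.lookup r y∈)) ∷
  mapAllPairs∈ (λ x∈ y∈ → f (there x∈) (there y∈)) rs

blocks-isPartition : (f : Fin n → Fin k) → Onto f → IsPartition (blocks f)
blocks-isPartition f onto = All.tabulate nonempty
                          , mapAllPairs∈ disjoint (blocks-unique f)
                          , λ x → lose (preimage∈blocks f (f x)) (x∈preimage⁺ f refl)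
  where
  nonempty : ∀ {p} → p ∈ˡ blocks f → Nonempty p
  nonempty p∈ with i , refl ← ∈-blocks⁻ f p∈ | x , fx≡i ← onto (proj₁ (∈-blocks⁻ f p∈)) =
    x , x∈preimage⁺ f fx≡i

  disjoint : ∀ {p q} → p ∈ˡ blocks f → q ∈ˡ blocks f → p ≢ q → Disjoint p q
  disjoint {p} {q} p∈ q∈ p≢q (x , x∈) with ∈-blocks⁻ f p∈ | ∈-blocks⁻ f q∈ | x∈p∩q⁻ p q x∈
  ... | i , refl | j , refl | x∈p , x∈q =
    p≢q (cong (preimage f) (trans (sym (x∈preimage⁻ f x∈p)) (x∈preimage⁻ f x∈q)))

partitions : ∀ n k → List (List (Subset n))
partitions n k = filter isPartition? (choose k (subsets n))

blocks∈partitions : (f : Fin n → Fin k) → Onto f → blocks f ∈ˡ partitions n k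
blocks∈partitions f onto =
  List.∈-filter⁺ isPartition? (blocks∈choose f onto) (blocks-isPartition f onto)

blocks-cong : (f g : Fin n → Fin k) → (∀ i → ∃ λ j → preimage f i ≡ preimage g j) →
              (∀ j → ∃ λ i → preimage g j ≡ preimage f i) → blocks f ≡ blocks g
blocks-cong f g f⇒g g⇒f = List.filter-≐ (isBlock? f) (isBlock? g)
  ( (λ { (i , refl) → f⇒g i }) , (λ { (j , refl) → g⇒f j }) ) (subsets _)

blocks-resp : {f g : Fin n → Fin k} → f ≗ g → blocks f ≡ blocks g
blocks-resp {f = f} {g} f≗g =
  blocks-cong f g (λ i → i , preimage-cong f≗g i) (λ i → i , sym (preimage-cong f≗g i))

-- Comparison of increasing functions, ties and partitions.

Increasing : (Fin n → Fin k) → Set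
Increasing f = Onto f × PreimageSizes _<_ f

increasing? : Decidable (Increasing {n} {k})
increasing? f = onto? f ×-dec preimageSizes? ℕ._<?_ f

HasTie : (Fin n → Fin k) → Set
HasTie f = ∃₂ λ i j → i Fin.< j × size f i ≡ size f j

hasTie? : Decidable (HasTie {n} {k})
hasTie? f = Fin.any? λ i → Fin.any? λ j → (i Fin.<? j) ×-dec (size f i ℕ.≟ size f j)

ties : ℕ → ℕ → ℕ
ties n k = length (filter hasTie? (functions n k))

Increasing-resp : {f g : Fin n → Fin k} → f ≗ g → Increasing f → Increasing g
Increasing-resp f≗g (onto , sizes) = Onto-resp f≗g onto , PreimageSizes-resp {_~_ = _<_} f≗g sizes

HasTie-resp : {f g : Fin n → Fin k} → f ≗ g → HasTie f → HasTie g
HasTie-resp f≗g (i , j , i<j , eq) =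
  i , j , i<j ,
  trans (cong ∣_∣ (sym (preimage-cong f≗g i))) (trans eq (cong ∣_∣ (preimage-cong f≗g j)))

T≤U : ∀ n k → T n k ≤ U n k
T≤U n k = length-filter-⊆ increasing? _
  (λ (onto , sizes) → onto , λ i j i<j → ℕ.<⇒≤ (sizes i j i<j)) (functions n k)

U≤T+ties : ∀ n k → U n k ≤ T n k + ties n k
U≤T+ties n k = length-filter-⊎ _ increasing? hasTie? split (functions n k)
  where
  split : ∀ {f : Fin n → Fin k} → Onto f × PreimageSizes _≤_ f → Increasing f ⊎ HasTie f
  split {f} (onto , sizes) with hasTie? f
  ... | yes tie  = inj₂ tie
  ... | no  ¬tie = inj₁ (onto , λ i j i<j → ℕ.≤∧≢⇒< (sizes i j i<j) λ eq → ¬tie (i , j , i<j , eq))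

strictMono⇒≤ : (σ : Fin k → Fin k) → (∀ {i j} → i Fin.< j → σ i Fin.< σ j) → ∀ i → i Fin.≤ σ i
strictMono⇒≤ {k} σ mono i = go (toℕ i) i refl
  where
  go : ∀ m (i : Fin k) → toℕ i ≡ m → m ≤ toℕ (σ i)
  go zero    i       _    = z≤n
  go (suc m) (suc i) refl = ℕ.≤-<-trans
    (go m (Fin.inject₁ i) (Fin.toℕ-inject₁ i)) (mono (s≤s (ℕ.≤-reflexive (Fin.toℕ-inject₁ i))))

-- Let `σ i` be the label under `g` of the block that `f` labels `i`. As sizes increase, `σ` is
-- strictly monotone, so `i ≤ σ i` and `size g i ≤ size g (σ i) = size f i`. By symmetry the sizes
-- agree, and strictness for `g` forces `σ i = i`.
increasing-determined : {f g : Fin n → Fin k} → Increasing f → Increasing g →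
                        blocks f ≡ blocks g → f ≗ g
increasing-determined {n} {k} {f} {g} f↑ g↑ eq = preimages-determine λ i →
  trans (proj₂ (match f g eq i)) (cong (preimage g) (σ≡id i))
  where
  match : ∀ (f g : Fin n → Fin k) → blocks f ≡ blocks g → ∀ i → ∃ λ j → preimage f i ≡ preimage g j
  match f g eq i = ∈-blocks⁻ g (subst (preimage f i ∈ˡ_) eq (preimage∈blocks f i))

  mono : ∀ (f : Fin n → Fin k) → PreimageSizes _<_ f → ∀ {i j} → i Fin.≤ j → size f i ≤ size f j
  mono f sizes {i} {j} i≤j with i Fin.≟ j
  ... | yes refl = ℕ.≤-refl
  ... | no  i≢j  = ℕ.<⇒≤ (sizes i j (Fin.≤∧≢⇒< i≤j i≢j))

  reflect : ∀ (f : Fin n → Fin k) → PreimageSizes _<_ f → ∀ {i j} → size f i < size f j → i Fin.< j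
  reflect f sizes lt = ℕ.≰⇒> λ j≤i → ℕ.<⇒≱ lt (mono f sizes j≤i)

  size-≤ : ∀ f g → Increasing f → Increasing g → blocks f ≡ blocks g →
           ∀ i → size g i ≤ size f i
  size-≤ f g (_ , f<) (_ , g<) eq i = begin
    size g i     ≤⟨ mono g g< (strictMono⇒≤ σ σ-mono i) ⟩
    size g (σ i) ≡⟨ cong ∣_∣ (proj₂ (match f g eq i)) ⟨
    size f i     ∎
    where
    open ℕ.≤-Reasoning
    σ : Fin k → Fin k
    σ i = proj₁ (match f g eq i)
    σ-mono : ∀ {i j} → i Fin.< j → σ i Fin.< σ j
    σ-mono {i} {j} i<j = reflect g g< (subst₂ _<_
      (cong ∣_∣ (proj₂ (match f g eq i))) (cong ∣_∣ (proj₂ (match f g eq j))) (f< i j i<j))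

  σ≡id : ∀ i → proj₁ (match f g eq i) ≡ i
  σ≡id i = Fin.≤-antisym
    (ℕ.≮⇒≥ (λ lt → ℕ.<⇒≢ (proj₂ g↑ _ _ lt) sizes≡))
    (ℕ.≮⇒≥ (λ lt → ℕ.<⇒≢ (proj₂ g↑ _ _ lt) (sym sizes≡)))
    where
    sizes≡ : size g i ≡ size g (proj₁ (match f g eq i))
    sizes≡ = trans (ℕ.≤-antisym (size-≤ f g f↑ g↑ eq i) (size-≤ g f g↑ f↑ (sym eq) i))
                   (cong ∣_∣ (proj₂ (match f g eq i)))

T≤S : ∀ n k → T n k ≤ S n k
-- `R` records `Increasing f` because the injectivity argument of `length-≤` sees nothing of `f` but
-- `R`.
T≤S n k = length-≤ {R = λ f bs → Increasing f × bs ≡ blocks f}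
  (AllPairs.filter⁺ increasing? (functions-distinct n k))
  (All.map (λ {f} f↑ → lose (blocks∈partitions f (proj₁ f↑)) (f↑ , refl))
    (All.all-filter increasing? (functions n k)))
  λ (f↑ , eq) (g↑ , eq′) f≇g → f≇g (increasing-determined f↑ g↑ (trans (sym eq) eq′))

-- Sorting the labels of an untied function.

injective⇒onto : (σ : Fin k → Fin k) → (∀ {i j} → σ i ≡ σ j → i ≡ j) → Onto σ
injective⇒onto {suc k} σ inj y with Fin.any? (λ x → σ x Fin.≟ y)
... | yes hit = hit
... | no miss = ⊥-elim (ℕ.1+n≰n (Fin.injective⇒≤ {f = λ x → Fin.punchOut (≢y x)}
                  (inj ∘ Fin.punchOut-injective (≢y _) (≢y _))))
  where
  ≢y : ∀ x → y ≢ σ x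
  ≢y x eq = miss (x , sym eq)

-- The permutation that sorts `s`: the new label of `i` is the number of `j` with `s j < s i`.
module Rank (s : Fin k → ℕ) (s-injective : ∀ {i j} → s i ≡ s j → i ≡ j) where

  below : Fin k → Subset k
  below i = Vec.tabulate λ j → does (s j ℕ.<? s i)

  ∈-below⁺ : ∀ {i j} → s j < s i → j ∈ below i
  ∈-below⁺ {i} {j} lt = Vec.lookup⇒[]= j _
    (trans (Vec.lookup∘tabulate _ j) (dec-true (s j ℕ.<? s i) lt))

  ∈-below⁻ : ∀ {i j} → j ∈ below i → s j < s i
  ∈-below⁻ {i} {j} j∈
    with trans (sym (Vec.lookup∘tabulate (λ j → does (s j ℕ.<? s i)) j)) (Vec.[]=⇒lookup j∈)
  ... | eq = ℕ.<ᵇ⇒< (s j) (s i) (subst Bool.T (sym eq) _)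

  rank<k : ∀ i → ∣ below i ∣ < k
  rank<k i = subst (∣ below i ∣ <_) (∣⊤∣≡n k)
    (p⊂q⇒∣p∣<∣q∣ ((λ _ → ∈⊤) , i , ∈⊤ , λ i∈ → ℕ.<-irrefl refl (∈-below⁻ i∈)))

  rank : Fin k → Fin k
  rank i = Fin.fromℕ< (rank<k i)

  rank-mono : ∀ {i j} → s i < s j → rank i Fin.< rank j
  rank-mono {i} {j} lt = subst₂ _<_
    (sym (Fin.toℕ-fromℕ< (rank<k i))) (sym (Fin.toℕ-fromℕ< (rank<k j)))
    (p⊂q⇒∣p∣<∣q∣ ( (λ x∈ → ∈-below⁺ (ℕ.<-trans (∈-below⁻ x∈) lt))
                 , i , ∈-below⁺ lt , λ i∈ → ℕ.<-irrefl refl (∈-below⁻ i∈)))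

  rank-reflect : ∀ {i j} → rank i Fin.< rank j → s i < s j
  rank-reflect {i} {j} lt with ℕ.<-cmp (s i) (s j)
  ... | tri< si<sj _ _ = si<sj
  ... | tri≈ _ eq _ rewrite s-injective eq = ⊥-elim (ℕ.<-irrefl refl lt)
  ... | tri> _ _ sj<si = ⊥-elim (ℕ.<-asym lt (rank-mono sj<si))

  rank-injective : ∀ {i j} → rank i ≡ rank j → i ≡ j
  rank-injective {i} {j} eq with ℕ.<-cmp (s i) (s j)
  ... | tri< lt _ _ = ⊥-elim (ℕ.<-irrefl (cong toℕ eq) (rank-mono lt))
  ... | tri≈ _ eq′ _ = s-injective eq′
  ... | tri> _ _ lt = ⊥-elim (ℕ.<-irrefl (cong toℕ (sym eq)) (rank-mono lt))

  rank-onto : Onto rank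
  rank-onto = injective⇒onto rank rank-injective

-- The existence counterpart of `increasing-determined`. Without ties the sizes are injective, so
-- composing `f` with their rank permutes the labels into increasing order and keeps the blocks.
sort : (f : Fin n → Fin k) → Onto f → ¬ HasTie f → ∃ λ g → Increasing g × blocks f ≡ blocks g
sort {k = k} f onto ¬tie = g , (g-onto , sizes) , blocks-cong f g (λ i → rank i , relabel i)
  λ j → case rank-onto j of λ { (i , refl) → i , sym (relabel i) }
  where
  distinct : ∀ {i j} → size f i ≡ size f j → i ≡ j
  distinct {i} {j} eq with Fin.<-cmp i j
  ... | tri< i<j _ _  = ⊥-elim (¬tie (i , j , i<j , eq))
  ... | tri≈ _ i≡j _  = i≡j
  ... | tri> _ _ j<i  = ⊥-elim (¬tie (j , i , j<i , sym eq))

  open Rank (size f) distinct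

  g = rank ∘ f

  relabel : ∀ i → preimage f i ≡ preimage g (rank i)
  relabel i = ⊆-antisym
    (λ x∈ → x∈preimage⁺ g (cong rank (x∈preimage⁻ f x∈)))
    (λ x∈ → x∈preimage⁺ f (rank-injective (x∈preimage⁻ g x∈)))

  g-onto : Onto g
  g-onto y with i , refl ← rank-onto y | x , refl ← onto (proj₁ (rank-onto y)) = x , refl

  sizes : PreimageSizes _<_ g
  sizes j j′ j<j′ with i , refl ← rank-onto j | i′ , refl ← rank-onto j′ =
    subst₂ _<_ (cong ∣_∣ (relabel i)) (cong ∣_∣ (relabel i′)) (rank-reflect j<j′)

-- Labelling the blocks of a given partition.

disjoint-here : ∀ {p : Subset n} {bs} → All (Disjoint p) bs → ∀ {x} → x ∈ p → Any (x ∈_) bs → ⊥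
disjoint-here (d ∷ _)  x∈p (here x∈q) = d (_ , x∈p∩q⁺ (x∈p , x∈q))
disjoint-here (_ ∷ ds) x∈p (there q)  = disjoint-here ds x∈p q

index-unique : ∀ {bs : List (Subset n)} → AllPairs Disjoint bs →
               ∀ {x} (p q : Any (x ∈_) bs) → index p ≡ index q
index-unique _        (here _)   (here _)   = refl
index-unique (d ∷ _)  (here x∈)  (there q)  = ⊥-elim (disjoint-here d x∈ q)
index-unique (d ∷ _)  (there p)  (here x∈)  = ⊥-elim (disjoint-here d x∈ p)
index-unique (_ ∷ ds) (there p)  (there q)  = cong suc (index-unique ds p q)

lose-at : {P : Pred A 0ℓ} (xs : List A) (i : Fin (length xs)) → P (lookup xs i) → Any P xs
lose-at (x ∷ xs) zero    Px = here Px
lose-at (x ∷ xs) (suc i) Px = there (lose-at xs i Px)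

index-lose-at : {P : Pred A 0ℓ} (xs : List A) (i : Fin (length xs)) (Px : P (lookup xs i)) →
                index (lose-at {P = P} xs i Px) ≡ i
index-lose-at (x ∷ xs) zero    Px = refl
index-lose-at (x ∷ xs) (suc i) Px = cong suc (index-lose-at xs i Px)

-- Each point is labelled by the position of its block in `bs`. Then `bs` and `blocks f` have the
-- same elements and both come from `choose k (subsets n)`, hence coincide by `choose-≡`.
partition⇒blocks : ∀ {bs : List (Subset n)} → bs ∈ˡ partitions n k →
                   ∃ λ (f : Fin n → Fin k) → Onto f × bs ≡ blocks f
partition⇒blocks {n} {k} {bs} bs∈
  with bs∈choose , ne , dis , cover ←
    List.∈-filter⁻ isPartition? {xs = choose k (subsets n)} bs∈
  -- The match identifies `k` with `length bs`, so positions in `bs` are labels without any cast.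
  with refl , _ ← ∈-choose⁻ k (subsets n) bs∈choose =
  f , onto , choose-≡ k (subsets-unique n) bs∈choose (blocks∈choose f onto)
    (λ p∈ → subst (_∈ˡ blocks f) (trans (preimage≡ (index p∈)) (sym (Any.lookup-index p∈)))
      (preimage∈blocks f (index p∈)))
    (λ p∈ → case ∈-blocks⁻ f p∈ of λ
      { (i , refl) → subst (_∈ˡ bs) (sym (preimage≡ i)) (List.∈-lookup i) })
  where
  f : Fin n → Fin k
  f x = index (cover x)

  f≡ : ∀ {x i} → x ∈ lookup bs i → f x ≡ i
  f≡ {x} {i} x∈ = trans (index-unique dis (cover x) (lose-at bs i x∈)) (index-lose-at bs i x∈)

  preimage≡ : ∀ i → preimage f i ≡ lookup bs i
  preimage≡ i = ⊆-antisym
    (λ {x} x∈ → subst (λ j → x ∈ lookup bs j) (x∈preimage⁻ f x∈) (Any.lookup-index (cover x)))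
    (λ x∈ → x∈preimage⁺ f (f≡ x∈))

  onto : Onto f
  onto i with x , x∈ ← All.lookup ne (List.∈-lookup {xs = bs} i) = x , f≡ x∈

-- A partition is labelled arbitrarily. A tied labelling is kept and an untied one is sorted; in
-- both cases `blocks` returns the partition, so the assignment is injective.
S≤T+ties : ∀ n k → S n k ≤ T n k + ties n k
S≤T+ties n k = subst (S n k ≤_) (List.length-++ (filter increasing? (functions n k)))
  (length-≤ {R = λ bs f → bs ≡ blocks f}
    (Unique.filter⁺ isPartition? (choose-unique k (subsets-unique n)))
    (All.tabulate λ bs∈ → let f , onto , eq = partition⇒blocks bs∈ in locate f onto eq)
    λ eq eq′ bs≢bs′ → bs≢bs′ (trans eq (sym eq′)))
  where
  locate : ∀ {bs} f → Onto f → bs ≡ blocks f →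
           Any (λ g → bs ≡ blocks g)
               (filter increasing? (functions n k) List.++ filter hasTie? (functions n k))
  locate f onto eq with hasTie? f
  ... | yes tie  = Any.++⁺ʳ (filter increasing? (functions n k))
    (Any.map (λ f≗g → trans eq (blocks-resp f≗g)) (∈-functions hasTie? HasTie-resp {f} tie))
  ... | no  ¬tie with g , g↑ , eq′ ← sort f onto ¬tie = Any.++⁺ˡ
    (Any.map (λ g≗h → trans eq (trans eq′ (blocks-resp g≗h)))
      (∈-functions increasing? Increasing-resp {g} g↑))

-- Onto functions against partitions.

onto : ℕ → ℕ → ℕ
onto n k = length (filter onto? (functions n k))

nonOnto : ℕ → ℕ → ℕ
nonOnto n k = length (filter (¬? ∘ onto?) (functions n k))

k^n≤onto+nonOnto : ∀ n k → k ^ n ≤ onto n k + nonOnto n k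
k^n≤onto+nonOnto n k = subst (_≤ onto n k + nonOnto n k)
  (trans (cong length (List.filter-all yes! {functions n k} (All.universal _ _)))
         (length-functions n k))
  (length-filter-⊎ yes! onto? (¬? ∘ onto?) (λ {f} _ → toSum (onto? f)) (functions n k))
  where
  yes! : Decidable {A = Fin n → Fin k} (λ _ → ⊤)
  yes! _ = yes _

length-cartesianProduct : (xs : List A) (ys : List B) →
                          length (cartesianProduct xs ys) ≡ length xs * length ys
length-cartesianProduct []       ys = refl
length-cartesianProduct (x ∷ xs) ys = trans (List.length-++ (map (x ,_) ys))
  (cong₂ _+_ (List.length-map (x ,_) ys) (length-cartesianProduct xs ys))

onto≤S*k^k : ∀ n k → onto n k ≤ S n k * k ^ k
onto≤S*k^k n k = subst (onto n k ≤_)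
  (trans (length-cartesianProduct (partitions n k) (functions k k))
         (cong (S n k *_) (length-functions k k)))
  (length-≤ {R = Labels} (AllPairs.filter⁺ onto? (functions-distinct n k))
    (All.map (λ {f} f-onto → label f f-onto) (All.all-filter onto? (functions n k)))
    determined)
  where
  -- Positions are compared through `toℕ` since `index p` lies in `Fin (length bs)` and `i` in
  -- `Fin k`. The covering condition gives every `x` a position, so that `(bs , σ)` determines `f`.
  Labels : REL (Fin n → Fin k) (List (Subset n) × (Fin k → Fin k)) 0ℓ
  Labels f (bs , σ) = (length bs ≡ k) × (∀ x → Any (x ∈_) bs) ×
    (∀ {x} (p : Any (x ∈_) bs) i → toℕ i ≡ toℕ (index p) → f x ≡ σ i)

  determined : ∀ {f g bsσ} → Labels f bsσ → Labels g bsσ → ¬ (f ≇ g)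
  determined (len , cover , f≡) (_ , _ , g≡) f≇g = f≇g λ x →
    let p = cover x ; i = Fin.cast len (index p) ; i≡ = Fin.toℕ-cast len (index p)
    in trans (f≡ p i i≡) (sym (g≡ p i i≡))

  label : ∀ f → Onto f → Any (Labels f) (cartesianProduct (partitions n k) (functions k k))
  label f f-onto = lose
    (List.∈-cartesianProduct⁺ (blocks∈partitions f f-onto)
      (List.∈-map⁺ finToFun (List.∈-allFin (funToFin σ))))
    (len , proj₂ (proj₂ (blocks-isPartition f f-onto)) ,
      λ p i i≡ → trans (f≡σ p i i≡) (sym (Fin.finToFun-funToFin σ i)))
    where
    len = length-blocks f f-onto

    block : ∀ i → ∃ λ j → lookup (blocks f) (Fin.cast (sym len) i) ≡ preimage f j
    block i = ∈-blocks⁻ f (List.∈-lookup (Fin.cast (sym len) i))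

    σ : Fin k → Fin k
    σ i = proj₁ (block i)

    f≡σ : ∀ {x} (p : Any (x ∈_) (blocks f)) i → toℕ i ≡ toℕ (index p) → f x ≡ σ i
    f≡σ {x} p i i≡ = x∈preimage⁻ f (subst (x ∈_)
      (trans (cong (lookup (blocks f)) index≡) (proj₂ (block i))) (Any.lookup-index p))
      where
      index≡ : index p ≡ Fin.cast (sym len) i
      index≡ = Fin.toℕ-injective (trans (sym i≡) (sym (Fin.toℕ-cast (sym len) i)))

-- Binomial averages

𝟙 : ∀ {P : Set} → Dec P → ℕ
𝟙 P? = if does P? then 1 else 0

-- mix q n g = Σₘ C(n,m) qⁿ⁻ᵐ g(m).
mix : ℕ → ℕ → (ℕ → ℕ) → ℕ
mix q zero    g = g 0
mix q (suc n) g = mix q n (g ∘ suc) + q * mix q n g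

mix-mono : ∀ q n {g h} → (∀ m → g m ≤ h m) → mix q n g ≤ mix q n h
mix-mono q zero    g≤h = g≤h 0
mix-mono q (suc n) g≤h = ℕ.+-mono-≤ (mix-mono q n (g≤h ∘ suc)) (ℕ.*-monoʳ-≤ q (mix-mono q n g≤h))

mix-cong : ∀ q n {g h} → g ≗ h → mix q n g ≡ mix q n h
mix-cong q zero    g≗h = g≗h 0
mix-cong q (suc n) g≗h = cong₂ (λ x y → x + q * y) (mix-cong q n (g≗h ∘ suc)) (mix-cong q n g≗h)

mix-+ : ∀ q n g h → mix q n (λ m → g m + h m) ≡ mix q n g + mix q n h
mix-+ q zero    g h = refl
mix-+ q (suc n) g h = trans
  (cong₂ (λ x y → x + q * y) (mix-+ q n (g ∘ suc) (h ∘ suc)) (mix-+ q n g h))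
  (rearrange q (mix q n (g ∘ suc)) (mix q n (h ∘ suc)) (mix q n g) (mix q n h))
  where
  rearrange : ∀ q a b c d → a + b + q * (c + d) ≡ a + q * c + (b + q * d)
  rearrange = solve-∀

mix-* : ∀ q n c g → mix q n (λ m → c * g m) ≡ c * mix q n g
mix-* q zero    c g = refl
mix-* q (suc n) c g = trans
  (cong₂ (λ x y → x + q * y) (mix-* q n c (g ∘ suc)) (mix-* q n c g))
  (rearrange q c (mix q n (g ∘ suc)) (mix q n g))
  where
  rearrange : ∀ q c a b → c * a + q * (c * b) ≡ c * (a + q * b)
  rearrange = solve-∀

-- The binomial theorem.
mix-2^ : ∀ q n → mix q n (2 ^_) ≡ (2 + q) ^ n
mix-2^ q zero    = refl
mix-2^ q (suc n) = trans
  (cong₂ (λ x y → x + q * y) (trans (mix-* q n 2 (2 ^_)) (cong (2 *_) (mix-2^ q n))) (mix-2^ q n))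
  (sym (ℕ.*-distribʳ-+ ((2 + q) ^ n) 2 q))

m*g[m-1] : (ℕ → ℕ) → ℕ → ℕ
m*g[m-1] g zero    = 0
m*g[m-1] g (suc m) = suc m * g m

-- m C(n+1,m) = (n+1) C(n,m-1), summed over m.
mix-absorb : ∀ q n g → mix q (suc n) (m*g[m-1] g) ≡ suc n * mix q n g
mix-absorb q zero    g = rearrange q (g 0)
  where
  rearrange : ∀ q x → 1 * x + q * 0 ≡ 1 * x
  rearrange = solve-∀
mix-absorb q (suc n) g = begin
  mix q (suc n) (λ m → suc m * g m) + q * mix q (suc n) (m*g[m-1] g)
    ≡⟨ cong₂ (λ x y → x + q * y)
         (trans (mix-cong q (suc n) shift) (mix-+ q (suc n) g (m*g[m-1] (g ∘ suc))))
         (mix-absorb q n g) ⟩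
  mix q (suc n) g + mix q (suc n) (m*g[m-1] (g ∘ suc)) + q * (suc n * mix q n g)
    ≡⟨ cong (λ x → mix q (suc n) g + x + q * (suc n * mix q n g)) (mix-absorb q n (g ∘ suc)) ⟩
  mix q (suc n) g + suc n * mix q n (g ∘ suc) + q * (suc n * mix q n g)
    ≡⟨ rearrange q (suc n) (mix q n (g ∘ suc)) (mix q n g) ⟩
  suc (suc n) * mix q (suc n) g ∎
  where
  open ≡-Reasoning
  -- Splitting off one `g m` leaves `m * g m`, which has the form `m*g[m-1]` for `g ∘ suc`. The
  -- induction hypothesis is thus used for both `g` and `g ∘ suc`.
  shift : ∀ m → suc m * g m ≡ g m + m*g[m-1] (g ∘ suc) m
  shift zero    = refl
  shift (suc m) = refl
  rearrange : ∀ q n a b → a + q * b + n * a + q * (n * b) ≡ (1 + n) * (a + q * b)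
  rearrange = solve-∀

-- Decay of binomial averages.

4*s*t≤[s+t]² : ∀ s t → 4 * s * t ≤ (s + t) * (s + t)
4*s*t≤[s+t]² s t with ℕ.≤-total s t
... | inj₁ s≤t with d , refl ← ℕ.m≤n⇒∃[o]m+o≡n s≤t =
  -- The two sides differ by the square of `d`, the distance between `s` and `t`.
  ℕ.m+n≤o⇒m≤o _ {d * d} (ℕ.≤-reflexive (lemma s d))
  where
  lemma : ∀ s d → 4 * s * (s + d) + d * d ≡ (s + (s + d)) * (s + (s + d))
  lemma = solve-∀
... | inj₂ t≤s with d , refl ← ℕ.m≤n⇒∃[o]m+o≡n t≤s =
  ℕ.m+n≤o⇒m≤o _ {d * d} (ℕ.≤-reflexive (lemma t d))
  where
  lemma : ∀ t d → 4 * (t + d) * t + d * d ≡ ((t + d) + t) * ((t + d) + t)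
  lemma = solve-∀

m*m≤n*n⇒m≤n : ∀ {m n} → m * m ≤ n * n → m ≤ n
m*m≤n*n⇒m≤n m²≤n² = ℕ.≮⇒≥ λ n<m → ℕ.<⇒≱ (ℕ.*-mono-< n<m n<m) m²≤n²

4^m≡2^m*2^m : ∀ m → 4 ^ m ≡ 2 ^ m * 2 ^ m
4^m≡2^m*2^m zero    = refl
4^m≡2^m*2^m (suc m) = trans (cong (4 *_) (4^m≡2^m*2^m m)) (rearrange (2 ^ m))
  where
  rearrange : ∀ x → 4 * (x * x) ≡ 2 * x * (2 * x)
  rearrange = solve-∀

-- From 4st ≤ (s + t)² with s = m + 1 and t = L².
linearise : ∀ L m x → x * x * suc m ≤ 4 ^ m → 2 * L * (suc m * x) ≤ suc m * 2 ^ m + L * L * 2 ^ m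
linearise L m x bound = m*m≤n*n⇒m≤n (begin
  2 * L * (suc m * x) * (2 * L * (suc m * x))
    ≡⟨ lhs L (suc m) x ⟩
  4 * suc m * (L * L) * (x * x * suc m)
    ≤⟨ ℕ.*-mono-≤ (4*s*t≤[s+t]² (suc m) (L * L)) (ℕ.≤-trans bound (ℕ.≤-reflexive (4^m≡2^m*2^m m))) ⟩
  (suc m + L * L) * (suc m + L * L) * (2 ^ m * 2 ^ m)
    ≡⟨ rhs (suc m) (L * L) (2 ^ m) ⟩
  (suc m * 2 ^ m + L * L * 2 ^ m) * (suc m * 2 ^ m + L * L * 2 ^ m) ∎)
  where
  open ℕ.≤-Reasoning
  lhs : ∀ L s x → 2 * L * (s * x) * (2 * L * (s * x)) ≡ 4 * s * (L * L) * (x * x * s)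
  lhs = solve-∀
  rhs : ∀ s t y → (s + t) * (s + t) * (y * y) ≡ (s * y + t * y) * (s * y + t * y)
  rhs = solve-∀

-- Multiplying by `suc n` lets `mix-absorb` bring in the factor that `linearise` needs termwise.
-- Both resulting sums are evaluated by `mix-2^`, and the lower bound on `n` makes the second at
-- most the first.
mix-decay : ∀ q L {g} → (∀ m → g m * g m * suc m ≤ 4 ^ m) →
            ∀ n → L * L * (2 + q) ≤ suc n → L * mix q n g ≤ (2 + q) ^ n
mix-decay q L {g} bound n large = ℕ.*-cancelˡ-≤ (2 * suc n) (begin
  2 * suc n * (L * mix q n g)
    ≡⟨ lhs (suc n) L (mix q n g) ⟩
  2 * L * (suc n * mix q n g)
    ≡⟨ cong (2 * L *_) (mix-absorb q n g) ⟨
  2 * L * mix q (suc n) (m*g[m-1] g)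
    ≡⟨ mix-* q (suc n) (2 * L) (m*g[m-1] g) ⟨
  mix q (suc n) (λ m → 2 * L * m*g[m-1] g m)
    ≤⟨ mix-mono q (suc n) pointwise ⟩
  mix q (suc n) (λ m → m*g[m-1] (2 ^_) m + L * L * 2 ^ m)
    ≡⟨ mix-+ q (suc n) (m*g[m-1] (2 ^_)) (λ m → L * L * 2 ^ m) ⟩
  mix q (suc n) (m*g[m-1] (2 ^_)) + mix q (suc n) (λ m → L * L * 2 ^ m)
    ≡⟨ cong₂ _+_ (trans (mix-absorb q n (2 ^_)) (cong (suc n *_) (mix-2^ q n)))
                 (trans (mix-* q (suc n) (L * L) (2 ^_)) (cong (L * L *_) (mix-2^ q (suc n)))) ⟩
  suc n * (2 + q) ^ n + L * L * ((2 + q) * (2 + q) ^ n)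
    ≡⟨ cong (λ x → suc n * (2 + q) ^ n + x) (ℕ.*-assoc (L * L) (2 + q) ((2 + q) ^ n)) ⟨
  suc n * (2 + q) ^ n + L * L * (2 + q) * (2 + q) ^ n
    ≤⟨ ℕ.+-monoʳ-≤ (suc n * (2 + q) ^ n) (ℕ.*-monoˡ-≤ ((2 + q) ^ n) large) ⟩
  suc n * (2 + q) ^ n + suc n * (2 + q) ^ n
    ≡⟨ rhs (suc n) ((2 + q) ^ n) ⟩
  2 * suc n * (2 + q) ^ n ∎)
  where
  open ℕ.≤-Reasoning
  pointwise : ∀ m → 2 * L * m*g[m-1] g m ≤ m*g[m-1] (2 ^_) m + L * L * 2 ^ m
  pointwise zero    = ℕ.≤-trans (ℕ.≤-reflexive (ℕ.*-zeroʳ (2 * L))) z≤n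
  pointwise (suc m) = ℕ.≤-trans (linearise L m (g m) (bound m))
    -- `linearise` yields `2 ^ m` at index `suc m`; it is enlarged to `2 ^ suc m` so that the sum is
    -- again an instance of `mix-2^`.
    (ℕ.+-monoʳ-≤ (suc m * 2 ^ m) (ℕ.*-monoʳ-≤ (L * L) (ℕ.m≤m+n (2 ^ m) _)))
  lhs : ∀ s L x → 2 * s * (L * x) ≡ 2 * L * (s * x)
  lhs = solve-∀
  rhs : ∀ s y → s * y + s * y ≡ 2 * s * y
  rhs = solve-∀

-- Lattice paths and central binomial coefficients.

-- The sum of F over the ends of the 2ᵐ unit-step lattice paths of length m
-- from (a , b).
steps : ℕ → (ℕ → ℕ → ℕ) → ℕ → ℕ → ℕ
steps zero    F a b = F a b
steps (suc m) F a b = steps m F (suc a) b + steps m F a (suc b)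

-- paths u v = C(u + v , u).
paths : ℕ → ℕ → ℕ
paths zero    v       = 1
paths (suc u) zero    = 1
paths (suc u) (suc v) = paths u (suc v) + paths (suc u) v

paths-comm : ∀ u v → paths u v ≡ paths v u
paths-comm zero    zero    = refl
paths-comm zero    (suc v) = refl
paths-comm (suc u) zero    = refl
paths-comm (suc u) (suc v) = trans (ℕ.+-comm (paths u (suc v)) _)
  (cong₂ _+_ (paths-comm (suc u) v) (paths-comm u (suc v)))

paths-zeroʳ : ∀ u → paths u 0 ≡ 1
paths-zeroʳ u = paths-comm u 0

paths-absorb : ∀ u v → suc u * paths (suc u) v ≡ suc (u + v) * paths u v
paths-absorb u zero    rewrite ℕ.+-identityʳ u | paths-zeroʳ u = refl
paths-absorb u (suc v) = begin
  suc u * (paths u (suc v) + paths (suc u) v)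
    ≡⟨ ℕ.*-distribˡ-+ (suc u) (paths u (suc v)) (paths (suc u) v) ⟩
  suc u * paths u (suc v) + suc u * paths (suc u) v
    -- The absorption identity at `u , v` is followed by its mirror image at `v , u` read backwards,
    -- which turns the factor `suc u` into `suc v`.
    ≡⟨ cong (suc u * paths u (suc v) +_) (trans (paths-absorb u v) (trans
         (cong₂ (λ s p → suc s * p) (ℕ.+-comm u v) (paths-comm u v))
         (trans (sym (paths-absorb v u)) (cong (suc v *_) (paths-comm (suc v) u))))) ⟩
  suc u * paths u (suc v) + suc v * paths u (suc v)
    ≡⟨ ℕ.*-distribʳ-+ (paths u (suc v)) (suc u) (suc v) ⟨
  suc (u + suc v) * paths u (suc v) ∎
  where open ≡-Reasoning

central-step : ∀ s → suc s * paths (suc s) (suc s) ≡ 2 * (suc (s + s) * paths s s)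
central-step s = begin
  suc s * (paths s (suc s) + paths (suc s) s)
    ≡⟨ cong (λ p → suc s * (p + paths (suc s) s)) (paths-comm s (suc s)) ⟩
  suc s * (paths (suc s) s + paths (suc s) s)
    ≡⟨ rearrange (suc s) (paths (suc s) s) ⟩
  2 * (suc s * paths (suc s) s)
    ≡⟨ cong (2 *_) (paths-absorb s s) ⟩
  2 * (suc (s + s) * paths s s) ∎
  where
  open ≡-Reasoning
  rearrange : ∀ s p → s * (p + p) ≡ 2 * (s * p)
  rearrange = solve-∀

-- Induction through `central-step`, after multiplication by `(s + 1)²`. The step amounts to
-- `4 (2s + 1) (2s + 3) ≤ 16 (s + 1)²`, whose sides differ by 4.
central-bound : ∀ s → paths s s * paths s s * suc (s + s) ≤ 4 ^ (s + s)
central-bound zero    = ℕ.≤-refl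
central-bound (suc s) = ℕ.*-cancelˡ-≤ (suc s * suc s) (begin
  suc s * suc s * (c′ * c′ * suc (suc s + suc s))
    ≡⟨ group (suc s) c′ (suc (suc s + suc s)) ⟩
  suc s * c′ * (suc s * c′) * suc (suc s + suc s)
    ≡⟨ cong (λ x → x * x * suc (suc s + suc s)) (central-step s) ⟩
  2 * (suc (s + s) * c) * (2 * (suc (s + s) * c)) * suc (suc s + suc s)
    ≡⟨ regroup s c ⟩
  4 * suc (s + s) * (3 + (s + s)) * (c * c * suc (s + s))
    ≤⟨ ℕ.*-mono-≤ (ℕ.m+n≤o⇒m≤o _ {4} (ℕ.≤-reflexive (square s))) (central-bound s) ⟩
  16 * (suc s * suc s) * 4 ^ (s + s)
    ≡⟨ final (suc s * suc s) (4 ^ (s + s)) ⟩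
  suc s * suc s * (4 * (4 * 4 ^ (s + s)))
    ≡⟨ cong (λ e → suc s * suc s * (4 * 4 ^ e)) (ℕ.+-suc s s) ⟨
  suc s * suc s * 4 ^ (suc s + suc s) ∎)
  where
  open ℕ.≤-Reasoning
  c  = paths s s
  c′ = paths (suc s) (suc s)
  group : ∀ s c t → s * s * (c * c * t) ≡ s * c * (s * c) * t
  group = solve-∀
  regroup : ∀ s c → 2 * ((1 + (s + s)) * c) * (2 * ((1 + (s + s)) * c)) *
                    (1 + ((1 + s) + (1 + s))) ≡
                    4 * (1 + (s + s)) * (3 + (s + s)) * (c * c * (1 + (s + s)))
  regroup = solve-∀
  square : ∀ s → 4 * (1 + (s + s)) * (3 + (s + s)) + 4 ≡ 16 * ((1 + s) * (1 + s))
  square = solve-∀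
  final : ∀ a x → 16 * a * x ≡ a * (4 * (4 * x))
  final = solve-∀

steps-shiftˡ : ∀ m F a b → steps m (λ a b → F (suc a) b) a b ≡ steps m F (suc a) b
steps-shiftˡ zero    F a b = refl
steps-shiftˡ (suc m) F a b = cong₂ _+_ (steps-shiftˡ m F (suc a) b) (steps-shiftˡ m F a (suc b))

steps-shiftʳ : ∀ m F a b → steps m (λ a b → F a (suc b)) a b ≡ steps m F a (suc b)
steps-shiftʳ zero    F a b = refl
steps-shiftʳ (suc m) F a b = cong₂ _+_ (steps-shiftʳ m F (suc a) b) (steps-shiftʳ m F a (suc b))

𝟙-yes : ∀ {P : Set} (P? : Dec P) → P → 𝟙 P? ≡ 1
𝟙-yes P? p = cong (if_then 1 else 0) (dec-true P? p)

𝟙-no : ∀ {P : Set} (P? : Dec P) → ¬ P → 𝟙 P? ≡ 0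
𝟙-no P? ¬p = cong (if_then 1 else 0) (dec-false P? ¬p)

equal : ℕ → ℕ → ℕ
equal a b = 𝟙 (a ℕ.≟ b)

steps-equal-> : ∀ m a b → b + m < a → steps m equal a b ≡ 0
steps-equal-> zero    a b b+0<a = 𝟙-no (a ℕ.≟ b) λ { refl → ℕ.m+n≮m a 0 b+0<a }
steps-equal-> (suc m) a b lt = cong₂ _+_
  (steps-equal-> m (suc a) b (ℕ.m<n⇒m<1+n (ℕ.≤-<-trans (ℕ.+-monoʳ-≤ b (ℕ.n≤1+n m)) lt)))
  (steps-equal-> m a (suc b) (subst (_< a) (ℕ.+-suc b m) lt))

steps-equal-< : ∀ m a b → a + m < b → steps m equal a b ≡ 0
steps-equal-< zero    a b a+0<b = 𝟙-no (a ℕ.≟ b) λ { refl → ℕ.m+n≮m a 0 a+0<b }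
steps-equal-< (suc m) a b lt = cong₂ _+_
  (steps-equal-< m (suc a) b (subst (_< b) (ℕ.+-suc a m) lt))
  (steps-equal-< m a (suc b) (ℕ.m<n⇒m<1+n (ℕ.≤-<-trans (ℕ.+-monoʳ-≤ a (ℕ.n≤1+n m)) lt)))

-- Every end point has coordinate sum `a + b + m`, and points on the diagonal have an even one.
steps-equal-odd : ∀ m a b s → a + b + m ≡ suc (2 * s) → steps m equal a b ≡ 0
steps-equal-odd zero    a b s odd = 𝟙-no (a ℕ.≟ b) λ
  { refl → ℕ.even≢odd a s (trans (double a) odd) }
  where
  double : ∀ a → 2 * a ≡ a + a + 0
  double = solve-∀
steps-equal-odd (suc m) a b s odd = cong₂ _+_
  (steps-equal-odd m (suc a) b s (trans (sym (ℕ.+-suc (a + b) m)) odd))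
  (steps-equal-odd m a (suc b) s (trans (shift a b m) odd))
  where
  shift : ∀ a b m → a + (1 + b) + m ≡ a + b + (1 + m)
  shift = solve-∀

steps-equal-paths : ∀ u v a b → a + u ≡ b + v → steps (u + v) equal a b ≡ paths u v
steps-equal-paths zero zero a b eq =
  𝟙-yes (a ℕ.≟ b) (trans (sym (ℕ.+-identityʳ a)) (trans eq (ℕ.+-identityʳ b)))
steps-equal-paths zero (suc v) a b eq = cong₂ _+_
  (steps-equal-> v (suc a) b (s≤s (ℕ.≤-trans (ℕ.+-monoʳ-≤ b (ℕ.n≤1+n v))
    (ℕ.≤-reflexive (trans (sym eq) (ℕ.+-identityʳ a))))))
  (steps-equal-paths zero v a (suc b) (trans eq (ℕ.+-suc b v)))
steps-equal-paths (suc u) zero a b eq = trans (cong₂ _+_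
  (steps-equal-paths u zero (suc a) b (trans (sym (ℕ.+-suc a u)) eq))
  (steps-equal-< (u + 0) a (suc b) (s≤s (ℕ.≤-trans
    (ℕ.+-monoʳ-≤ a (ℕ.≤-trans (ℕ.≤-reflexive (ℕ.+-identityʳ u)) (ℕ.n≤1+n u)))
    (ℕ.≤-reflexive (trans eq (ℕ.+-identityʳ b)))))))
  (trans (ℕ.+-identityʳ _) (paths-zeroʳ u))
steps-equal-paths (suc u) (suc v) a b eq = cong₂ _+_
  (steps-equal-paths u (suc v) (suc a) b (trans (sym (ℕ.+-suc a u)) eq))
  (trans (cong (λ m → steps m equal a (suc b)) (ℕ.+-suc u v))
    (steps-equal-paths (suc u) v a (suc b) (trans eq (ℕ.+-suc b v))))

even⊎odd : ∀ m → ∃ λ s → m ≡ s + s ⊎ m ≡ suc (2 * s)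
even⊎odd zero = 0 , inj₁ refl
even⊎odd (suc m) with even⊎odd m
... | s , inj₁ refl = s , inj₂ (cong (λ x → suc (s + x)) (sym (ℕ.+-identityʳ s)))
... | s , inj₂ refl = suc s , inj₁ (cong suc
  (trans (cong (λ x → suc (s + x)) (ℕ.+-identityʳ s)) (sym (ℕ.+-suc s s))))

steps-equal-bound : ∀ m → steps m equal 0 0 * steps m equal 0 0 * suc m ≤ 4 ^ m
steps-equal-bound m with even⊎odd m
... | s , inj₁ refl rewrite steps-equal-paths s s 0 0 refl = central-bound s
... | s , inj₂ refl rewrite steps-equal-odd (suc (2 * s)) 0 0 s refl = z≤n

null : ℕ → ℕ → ℕ
null a b = 𝟙 (a ℕ.≟ 0)

steps-null : ∀ m a b → steps m null (suc a) b ≡ 0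
steps-null zero    a b = refl
steps-null (suc m) a b = cong₂ _+_ (steps-null m (suc a) b) (steps-null m a (suc b))

steps-null₀ : ∀ m b → steps m null 0 b ≡ 1
steps-null₀ zero    b = refl
steps-null₀ (suc m) b = cong₂ _+_ (steps-null m 0 b) (steps-null₀ m (suc b))

-- One path alone is counted, the one that never moves in the first direction. The crude bound gives
-- missed values the form of hypothesis used for ties, so `count-decay` serves both.
steps-null-bound : ∀ m → steps m null 0 0 * steps m null 0 0 * suc m ≤ 4 ^ m
steps-null-bound m rewrite steps-null₀ m 0 =
  subst (_≤ 4 ^ m) (sym (ℕ.+-identityʳ (suc m))) (1+m≤4^m m)
  where
  1+m≤4^m : ∀ m → suc m ≤ 4 ^ m
  1+m≤4^m zero    = ℕ.≤-refl
  1+m≤4^m (suc m) = ℕ.+-mono-≤ (ℕ.m^n>0 4 m) (ℕ.≤-trans (1+m≤4^m m) (ℕ.m≤m+n (4 ^ m) _))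

-- Words and the numbers of occurrences of two letters

Σ[_] : List A → (A → ℕ) → ℕ
Σ[ xs ] g = ListAction.sum (map g xs)

Σ-cartesianProductWith : {C : Set} (h : A → B → C) (xs : List A) (ys : List B) (g : C → ℕ) →
  Σ[ cartesianProductWith h xs ys ] g ≡ Σ[ xs ] (λ x → Σ[ ys ] (g ∘ h x))
Σ-cartesianProductWith h []       ys g = refl
Σ-cartesianProductWith h (x ∷ xs) ys g = begin
  ListAction.sum (map g (map (h x) ys List.++ cartesianProductWith h xs ys))
    ≡⟨ cong ListAction.sum (List.map-++ g (map (h x) ys) _) ⟩
  ListAction.sum (map g (map (h x) ys) List.++ map g (cartesianProductWith h xs ys))
    ≡⟨ ListAction.sum-++ (map g (map (h x) ys)) _ ⟩
  ListAction.sum (map g (map (h x) ys)) + Σ[ cartesianProductWith h xs ys ] g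
    ≡⟨ cong₂ _+_ (cong ListAction.sum (sym (List.map-∘ ys))) (Σ-cartesianProductWith h xs ys g) ⟩
  Σ[ ys ] (g ∘ h x) + Σ[ xs ] (λ x → Σ[ ys ] (g ∘ h x)) ∎
  where open ≡-Reasoning

Σ-cong : (xs : List A) {g h : A → ℕ} → g ≗ h → Σ[ xs ] g ≡ Σ[ xs ] h
Σ-cong xs g≗h = cong ListAction.sum (List.map-cong g≗h xs)

length-filter-Σ : {P : Pred A 0ℓ} (P? : Decidable P) (xs : List A) →
                  length (filter P? xs) ≡ Σ[ xs ] (𝟙 ∘ P?)
length-filter-Σ P? [] = refl
length-filter-Σ P? (x ∷ xs) with P? x
... | yes _ = cong suc (length-filter-Σ P? xs)
... | no  _ = length-filter-Σ P? xs

Σ-allFin : ∀ n (g : Fin n → ℕ) → Σ[ allFin n ] g ≡ sum g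
Σ-allFin n g = trans (cong ListAction.sum (List.map-tabulate id g)) (go n g)
  where
  go : ∀ n (g : Fin n → ℕ) → ListAction.sum (List.tabulate g) ≡ sum g
  go zero    g = refl
  go (suc n) g = cong (g zero +_) (go n (g ∘ suc))

sum-const : ∀ n {g : Fin n → ℕ} {z} → (∀ i → g i ≡ z) → sum g ≡ n * z
sum-const zero    g≡z = refl
sum-const (suc n) g≡z = cong₂ _+_ (g≡z zero) (sum-const n (g≡z ∘ suc))

sum-two : ∀ q (g : Fin (2 + q) → ℕ) {i j z} → i ≢ j → (∀ {c} → c ≢ i → c ≢ j → g c ≡ z) →
          sum g ≡ g i + (g j + q * z)
sum-two q g {i} {j} i≢j g≡z = begin
  sum g                                ≡⟨ sum-remove {i = i} g ⟩
  g i + sum g′                         ≡⟨ cong (g i +_) (sum-remove {i = j′} g′) ⟩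
  g i + (g′ j′ + sum (removeAt g′ j′)) ≡⟨ cong₂ (λ x y → g i + (g x + y)) (Fin.punchIn-punchOut i≢j)
    (sum-const q λ c → g≡z (Fin.punchInᵢ≢i i _) λ eq → Fin.punchInᵢ≢i j′ c
      (Fin.punchIn-injective i _ _ (trans eq (sym (Fin.punchIn-punchOut i≢j))))) ⟩
  g i + (g j + q * _)                  ∎
  where
  open ≡-Reasoning
  g′ = removeAt g i
  j′ = Fin.punchOut i≢j

-- An enumeration that peels off the first letter and so supports induction on `n`, unlike
-- `functions`, which is indexed by `Fin (k ^ n)`.
words : ∀ k n → List (Vec (Fin k) n)
words k zero    = Vec.[] ∷ []
words k (suc n) = cartesianProductWith Vec._∷_ (allFin k) (words k n)

∈-words : ∀ {k n} (v : Vec (Fin k) n) → v ∈ˡ words k n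
∈-words Vec.[]      = here refl
∈-words (c Vec.∷ v) = List.∈-cartesianProductWith⁺ Vec._∷_ (List.∈-allFin c) (∈-words v)

occ : ∀ {k n} → Vec (Fin k) n → Fin k → ℕ
occ v = size (Vec.lookup v)

occ-≡ : ∀ {k n} (v : Vec (Fin k) n) {c i} → c ≡ i → occ (c Vec.∷ v) i ≡ suc (occ v i)
occ-≡ v {c} {i} c≡i with c Fin.≟ i
... | yes _  = refl
... | no c≢i = ⊥-elim (c≢i c≡i)

occ-≢ : ∀ {k n} (v : Vec (Fin k) n) {c i} → c ≢ i → occ (c Vec.∷ v) i ≡ occ v i
occ-≢ v {c} {i} c≢i with c Fin.≟ i
... | yes c≡i = ⊥-elim (c≢i c≡i)
... | no _    = refl

module _ {q : ℕ} {i j : Fin (2 + q)} (i≢j : i ≢ j) where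

  total : ∀ n → (ℕ → ℕ → ℕ) → ℕ
  total n F = Σ[ words (2 + q) n ] (λ v → F (occ v i) (occ v j))

  -- The first letter is `i`, `j` or one of the `q` others, and the others change neither count.
  total-suc : ∀ n F → total (suc n) F ≡
              total n (λ a b → F (suc a) b) + (total n (λ a b → F a (suc b)) + q * total n F)
  total-suc n F = begin
    total (suc n) F
      ≡⟨ Σ-cartesianProductWith Vec._∷_ (allFin (2 + q)) (words (2 + q) n) _ ⟩
    Σ[ allFin (2 + q) ] g
      ≡⟨ Σ-allFin (2 + q) g ⟩
    sum g
      ≡⟨ sum-two q g i≢j (λ c≢i c≢j →
           Σ-cong (words (2 + q) n) λ v → cong₂ F (occ-≢ v c≢i) (occ-≢ v c≢j)) ⟩
    g i + (g j + q * total n F)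
      ≡⟨ cong₂ (λ x y → x + (y + q * total n F))
           (Σ-cong (words (2 + q) n) λ v → cong₂ F (occ-≡ v refl) (occ-≢ v i≢j))
           (Σ-cong (words (2 + q) n) λ v → cong₂ F (occ-≢ v (≢-sym i≢j)) (occ-≡ v refl)) ⟩
    total n (λ a b → F (suc a) b) + (total n (λ a b → F a (suc b)) + q * total n F) ∎
    where
    open ≡-Reasoning
    g : Fin (2 + q) → ℕ
    g c = Σ[ words (2 + q) n ] (λ v → F (occ (c Vec.∷ v) i) (occ (c Vec.∷ v) j))

  -- Grouping the words by the number m of letters that are i or j.
  total-mix : ∀ n F → total n F ≡ mix q n (λ m → steps m F 0 0)
  total-mix zero    F = ℕ.+-identityʳ (F 0 0)
  total-mix (suc n) F = begin
    total (suc n) F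
      ≡⟨ total-suc n F ⟩
    total n (λ a b → F (suc a) b) + (total n (λ a b → F a (suc b)) + q * total n F)
      ≡⟨ cong₂ _+_ (trans (total-mix n _) (mix-cong q n λ m → steps-shiftˡ m F 0 0))
           (cong₂ (λ x y → x + q * y)
             (trans (total-mix n _) (mix-cong q n λ m → steps-shiftʳ m F 0 0)) (total-mix n F)) ⟩
    mix q n (at 1 0) + (mix q n (at 0 1) + q * mix q n (at 0 0))
      ≡⟨ ℕ.+-assoc (mix q n (at 1 0)) _ _ ⟨
    mix q n (at 1 0) + mix q n (at 0 1) + q * mix q n (at 0 0)
      ≡⟨ cong (_+ q * mix q n (at 0 0)) (mix-+ q n _ _) ⟨
    mix q (suc n) (at 0 0) ∎
    where
    open ≡-Reasoning
    at : ℕ → ℕ → ℕ → ℕ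
    at a b m = steps m F a b

  -- Tabulation injects the functions into the words, where `total-mix` turns the count into a
  -- binomial average for `mix-decay`.
  count-decay : {Q : Rel ℕ 0ℓ} (Q? : Decidable₂ Q) →
                let g = λ m → steps m (λ a b → 𝟙 (Q? a b)) 0 0 in
                (∀ m → g m * g m * suc m ≤ 4 ^ m) →
                ∀ L n → L * L * (2 + q) ≤ suc n →
                L * length (filter (λ f → Q? (size f i) (size f j)) (functions n (2 + q))) ≤
                (2 + q) ^ n
  count-decay {Q} Q? bound L n large = ℕ.≤-trans (ℕ.*-monoʳ-≤ L (begin
    length (filter Qᶠ? (functions n (2 + q)))
      ≤⟨ length-≤ {R = λ f v → f ≗ Vec.lookup v}
           (AllPairs.filter⁺ Qᶠ? (functions-distinct n (2 + q)))
           (All.map (λ {f} → locate f) (All.all-filter Qᶠ? (functions n (2 + q))))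
           (λ f≗v g≗v f≇g → f≇g (λ x → trans (f≗v x) (sym (g≗v x)))) ⟩
    length (filter Qʷ? (words (2 + q) n))
      ≡⟨ length-filter-Σ Qʷ? (words (2 + q) n) ⟩
    total n (λ a b → 𝟙 (Q? a b))
      ≡⟨ total-mix n _ ⟩
    mix q n (λ m → steps m (λ a b → 𝟙 (Q? a b)) 0 0) ∎)) (mix-decay q L bound n large)
    where
    open ℕ.≤-Reasoning
    Qᶠ? : Decidable {A = Fin n → Fin (2 + q)} (λ f → Q (size f i) (size f j))
    Qᶠ? f = Q? (size f i) (size f j)
    Qʷ? : Decidable {A = Vec (Fin (2 + q)) n} (λ v → Q (occ v i) (occ v j))
    Qʷ? v = Q? (occ v i) (occ v j)
    size≡ : ∀ f i → size f i ≡ occ (Vec.tabulate f) i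
    size≡ f i = cong ∣_∣ (preimage-cong (sym ∘ Vec.lookup∘tabulate f) i)
    locate : ∀ f → Q (size f i) (size f j) →
             Any (λ v → f ≗ Vec.lookup v) (filter Qʷ? (words (2 + q) n))
    locate f Qf = lose
      (List.∈-filter⁺ Qʷ? (∈-words (Vec.tabulate f)) (subst₂ Q (size≡ f i) (size≡ f j) Qf))
      (sym ∘ Vec.lookup∘tabulate f)

-- Union bounds for non-onto and tied functions.

union-bound : {P : Pred A 0ℓ} {Q : B → Pred A 0ℓ}
              (P? : Decidable P) (Q? : ∀ y → Decidable (Q y))
              (xs : List A) (ys : List B) → ∀ L {M} → (∀ {x} → P x → Any (λ y → Q y x) ys) →
              (∀ y → L * length (filter (Q? y) xs) ≤ M) → L * length (filter P? xs) ≤ length ys * M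
union-bound P? Q? xs [] L cover bound
  rewrite List.filter-none P? (All.universal (λ x Px → case cover Px of λ ()) xs) =
  ℕ.≤-reflexive (ℕ.*-zeroʳ L)
union-bound {Q = Q} P? Q? xs (y ∷ ys) L {M} cover bound = begin
  L * length (filter P? xs)
    ≤⟨ ℕ.*-monoʳ-≤ L (length-filter-⊎ P? (Q? y) rest? (Any.toSum ∘ cover) xs) ⟩
  L * (length (filter (Q? y) xs) + length (filter rest? xs))
    ≡⟨ ℕ.*-distribˡ-+ L (length (filter (Q? y) xs)) _ ⟩
  L * length (filter (Q? y) xs) + L * length (filter rest? xs)
    ≤⟨ ℕ.+-mono-≤ (bound y) (union-bound rest? Q? xs ys L id bound) ⟩
  M + length ys * M ∎
  where
  open ℕ.≤-Reasoning
  rest? : Decidable (λ x → Any (λ y → Q y x) ys)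
  rest? x = Any.any? (λ y → Q? y x) ys

nonOnto-decay : ∀ q L n → L * L * (2 + q) ≤ suc n → L * nonOnto n (2 + q) ≤ (2 + q) * (2 + q) ^ n
nonOnto-decay q L n large = subst (λ l → L * nonOnto n (2 + q) ≤ l * (2 + q) ^ n)
  (List.length-tabulate {n = 2 + q} id)
  (union-bound (¬? ∘ onto?) (λ i f → size f i ℕ.≟ 0) (functions n (2 + q)) (allFin (2 + q)) L missed
    -- The test concerns `i` only; `punchIn i zero` serves as the second, distinct letter that
    -- `count-decay` asks for.
    λ i → count-decay (≢-sym (Fin.punchInᵢ≢i i zero)) (λ a b → a ℕ.≟ 0) steps-null-bound L n large)
  where
  missed : ∀ {f : Fin n → Fin (2 + q)} → ¬ Onto f → Any (λ i → size f i ≡ 0) (allFin (2 + q))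
  missed {f} ¬onto with i , miss ← Fin.¬∀⟶∃¬ (2 + q) _ (λ y → Fin.any? λ x → f x Fin.≟ y) ¬onto =
    lose (List.∈-allFin i) (trans
      (cong ∣_∣ (Empty-unique λ (x , x∈) → miss (x , x∈preimage⁻ f x∈))) (∣⊥∣≡0 n))

ties-decay : ∀ q L n → L * L * (2 + q) ≤ suc n →
             L * ties n (2 + q) ≤ (2 + q) * (2 + q) * (2 + q) ^ n
ties-decay q L n large = subst (λ l → L * ties n K ≤ l * K ^ n)
  (trans (length-cartesianProduct (allFin K) (allFin K)) (cong₂ _*_ length-allFin length-allFin))
  (union-bound hasTie? tie? (functions n K) (cartesianProduct (allFin K) (allFin K)) L
    (λ (i , j , tie) → lose (List.∈-cartesianProduct⁺ (List.∈-allFin i) (List.∈-allFin j)) tie)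
    pair)
  where
  K = 2 + q

  length-allFin : length (allFin K) ≡ K
  length-allFin = List.length-tabulate {n = K} id

  tie? : ∀ ((i , j) : Fin K × Fin K) →
         Decidable (λ (f : Fin n → Fin K) → i Fin.< j × size f i ≡ size f j)
  tie? (i , j) f = (i Fin.<? j) ×-dec (size f i ℕ.≟ size f j)

  pair : ∀ ij → L * length (filter (tie? ij) (functions n K)) ≤ K ^ n
  pair (i , j) = case i Fin.<? j of λ where
    (yes i<j) → ℕ.≤-trans (ℕ.*-monoʳ-≤ L (length-filter-⊆ (tie? (i , j)) _ proj₂ (functions n K)))
      (count-decay (Fin.<⇒≢ i<j) ℕ._≟_ steps-equal-bound L n large)
    -- These pairs witness no tie and contribute zero; they appear only because the union runs over
    -- all `K * K` pairs.
    (no ¬i<j) → ℕ.≤-trans (ℕ.≤-reflexive (trans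
      (cong (λ l → L * length l) (List.filter-none (tie? (i , j)) {functions n K}
        (All.universal (λ _ (i<j , _) → ¬i<j i<j) _)))
      (ℕ.*-zeroʳ L))) z≤n

-- The limits

open import Data.Integer.Base using (+_)

eventually-small-ties : ∀ q M → ∃ λ N → ∀ n → N ≤ n →
                        0 < S n (2 + q) × M * ties n (2 + q) ≤ S n (2 + q)
eventually-small-ties q M = N₁ + N₂ , λ n N≤n →
  positive n (large₁ n N≤n) , few n (large₁ n N≤n) (large₂ n N≤n)
  where
  open ℕ.≤-Reasoning
  K  = 2 + q
  -- `L₁` makes at most half of all functions non-onto, whence `K ^ n ≤ c * S n K`. `L₂` then
  -- absorbs the `K * K` of the union bound, this `c` and the target factor `M`.
  c  = 2 * K ^ K
  L₁ = K * 2
  L₂ = K * K * c * M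
  N₁ = L₁ * L₁ * K
  N₂ = L₂ * L₂ * K

  large₁ : ∀ n → N₁ + N₂ ≤ n → N₁ ≤ suc n
  large₁ n N≤n = ℕ.m≤n⇒m≤1+n (ℕ.≤-trans (ℕ.m≤m+n N₁ N₂) N≤n)

  large₂ : ∀ n → N₁ + N₂ ≤ n → N₂ ≤ suc n
  large₂ n N≤n = ℕ.m≤n⇒m≤1+n (ℕ.≤-trans (ℕ.m≤n+m N₂ N₁) N≤n)

  K^n≤cS : ∀ n → N₁ ≤ suc n → K ^ n ≤ c * S n K
  -- The total is doubled so that twice the non-onto functions cancel against one copy of `K ^ n`.
  K^n≤cS n large = ℕ.+-cancelʳ-≤ (K ^ n) _ _ (begin
    K ^ n + K ^ n
      ≤⟨ ℕ.+-mono-≤ (k^n≤onto+nonOnto n K) (k^n≤onto+nonOnto n K) ⟩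
    onto n K + nonOnto n K + (onto n K + nonOnto n K)
      ≡⟨ double (onto n K) (nonOnto n K) ⟩
    2 * onto n K + 2 * nonOnto n K
      ≤⟨ ℕ.+-mono-≤ (ℕ.*-monoʳ-≤ 2 (onto≤S*k^k n K)) half ⟩
    2 * (S n K * K ^ K) + K ^ n
      ≡⟨ cong (_+ K ^ n) (rearrange (S n K) (K ^ K)) ⟩
    c * S n K + K ^ n ∎)
    where
    half : 2 * nonOnto n K ≤ K ^ n
    half = ℕ.*-cancelˡ-≤ K (subst (_≤ K * K ^ n) (ℕ.*-assoc K 2 (nonOnto n K))
      (nonOnto-decay q L₁ n large))
    double : ∀ x y → x + y + (x + y) ≡ 2 * x + 2 * y
    double = solve-∀
    rearrange : ∀ x y → 2 * (x * y) ≡ 2 * y * x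
    rearrange = solve-∀

  positive : ∀ n → N₁ ≤ suc n → 0 < S n K
  positive n large = ℕ.n≢0⇒n>0 λ S≡0 → ℕ.<⇒≱ (ℕ.m^n>0 K n)
    (ℕ.≤-trans (K^n≤cS n large) (ℕ.≤-reflexive (trans (cong (c *_) S≡0) (ℕ.*-zeroʳ c))))

  few : ∀ n → N₁ ≤ suc n → N₂ ≤ suc n → M * ties n K ≤ S n K
  few n large₁ large₂ = ℕ.*-cancelˡ-≤ (K * K * c) {{KKc≢0}} (begin
    K * K * c * (M * ties n K) ≡⟨ ℕ.*-assoc (K * K * c) M (ties n K) ⟨
    L₂ * ties n K              ≤⟨ ties-decay q L₂ n large₂ ⟩
    K * K * K ^ n              ≤⟨ ℕ.*-monoʳ-≤ (K * K) (K^n≤cS n large₁) ⟩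
    K * K * (c * S n K)        ≡⟨ ℕ.*-assoc (K * K) c (S n K) ⟨
    K * K * c * S n K          ∎)
    where
    KKc≢0 : ℕ.NonZero (K * K * c)
    KKc≢0 = ℕ.m*n≢0 (K * K) c {{_}} {{ℕ.m*n≢0 2 (K ^ K) {{_}} {{ℕ.m^n≢0 K K}}}}

∣⊖∣≤ : ∀ {a b t} → a ≤ b + t → b ≤ a + t → ℤ.∣ a ℤ.⊖ b ∣ ≤ t
∣⊖∣≤ {a} {b} {t} a≤b+t b≤a+t with ℕ.≤-total a b
... | inj₁ a≤b = subst (_≤ t) (sym (ℤ.∣⊖∣-≤ a≤b)) (ℕ.m≤n+o⇒m∸n≤o b a b≤a+t)
... | inj₂ b≤a = subst (_≤ t) (sym (trans (ℤ.∣m⊖n∣≡∣n⊖m∣ a b) (ℤ.∣⊖∣-≤ b≤a)))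
  (ℕ.m≤n+o⇒m∸n≤o a b a≤b+t)

-- The distance of `a / b` from 1 is at most `t / b`, while `ε` is at least the reciprocal of its
-- denominator. The extra `suc` in the last hypothesis makes the comparison strict when `t` is
-- positive; for `t = 0` strictness comes from `0 < b`.
÷-close : ∀ {a b t} ε → 0ℚ ℚ.< ε → 0 < b → a ≤ b + t → b ≤ a + t → suc (ℚ.↧ₙ ε) * t ≤ b →
          ℚ.∣ a ÷ b ℚ.- 1ℚ ∣ ℚ.< ε
÷-close {a} {suc b} {t} ε@(mkℚ +[1+ p ] d _) _ _ a≤b+t b≤a+t small = ℚ.toℚᵘ-cancel-< (begin-strict
  toℚᵘ ℚ.∣ a ÷ suc b ℚ.- 1ℚ ∣
    ≃⟨ ℚ.toℚᵘ-homo-∣-∣ (a ÷ suc b ℚ.- 1ℚ) ⟩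
  ℚᵘ.∣ toℚᵘ (a ÷ suc b ℚ.- 1ℚ) ∣
    ≃⟨ ℚᵘ.∣-∣-cong (ℚᵘ.≃-trans (ℚ.toℚᵘ-homo-+ (a ÷ suc b) (ℚ.- 1ℚ))
         (ℚᵘ.+-congˡ (toℚᵘ (ℚ.- 1ℚ)) (ℚ.toℚᵘ-fromℚᵘ (mkℚᵘ (+ a) b)))) ⟩
  ℚᵘ.∣ mkℚᵘ (+ a) b ℚᵘ.+ toℚᵘ (ℚ.- 1ℚ) ∣
    ≃⟨ ℚᵘ.*≡* (cong₂ ℤ._*_ (cong (λ z → + ℤ.∣ z ∣) numerator≡)
         (cong +_ (sym (ℕ.*-identityʳ (suc b))))) ⟩
  mkℚᵘ (+ ℤ.∣ a ℤ.⊖ suc b ∣) b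
    <⟨ ℚᵘ.*<* (subst₂ ℤ._<_ (ℤ.pos-* ℤ.∣ a ℤ.⊖ suc b ∣ (suc d))
         (ℤ.pos-* (suc p) (suc b)) (ℤ.+<+ cross)) ⟩
  toℚᵘ ε ∎)
  where
  open ℚᵘ.≤-Reasoning
  numerator≡ : + a ℤ.* + 1 ℤ.+ -[1+ 0 ] ℤ.* +[1+ b ] ≡ a ℤ.⊖ suc b
  numerator≡ = trans (cong₂ ℤ._+_ (ℤ.*-identityʳ (+ a)) (ℤ.-1*i≡-i +[1+ b ])) (ℤ.m-n≡m⊖n a (suc b))

  t*D<b : ∀ t → suc (suc d) * t ≤ suc b → t * suc d < suc b
  t*D<b zero    _     = s≤s z≤n
  t*D<b (suc t) small = ℕ.<-≤-trans (ℕ.*-monoʳ-< (suc t) (ℕ.n<1+n (suc d)))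
    (subst (_≤ suc b) (ℕ.*-comm (suc (suc d)) (suc t)) small)

  cross : ℤ.∣ a ℤ.⊖ suc b ∣ * suc d < suc p * suc b
  cross = ℕ.≤-<-trans (ℕ.*-monoˡ-≤ (suc d) (∣⊖∣≤ a≤b+t b≤a+t))
    (ℕ.<-≤-trans (t*D<b t small) (ℕ.m≤m+n (suc b) _))
÷-close (mkℚ (+ 0) _ _) (ℚ.*<* (ℤ.+<+ ()))
÷-close (mkℚ -[1+ _ ] _ _) (ℚ.*<* ())

÷⟶1 : (a s t : ℕ → ℕ) → (∀ M → ∃ λ N → ∀ n → N ≤ n → 0 < s n × M * t n ≤ s n) →
      (∀ n → a n ≤ s n + t n) → (∀ n → s n ≤ a n + t n) → (λ n → a n ÷ s n) ⟶ 1ℚ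
÷⟶1 a s t t≪s a≤s+t s≤a+t ε ε>0 with N , small ← t≪s (suc (ℚ.↧ₙ ε)) = N , λ n N≤n →
  ÷-close {t = t n} ε ε>0 (proj₁ (small n N≤n)) (a≤s+t n) (s≤a+t n) (proj₂ (small n N≤n))

corollary3 : (k : ℕ) → 3 ≤ k →
    ((λ n → T n k ÷ S n k) ⟶ 1ℚ) × ((λ n → U n k ÷ S n k) ⟶ 1ℚ)
corollary3 (suc zero)      (s≤s ())
corollary3 k@(suc (suc q)) _ =
  ÷⟶1 (λ n → T n k) (λ n → S n k) (λ n → ties n k) (eventually-small-ties q)
    (λ n → ℕ.≤-trans (T≤S n k) (ℕ.m≤m+n (S n k) (ties n k)))
    (λ n → S≤T+ties n k) ,
  ÷⟶1 (λ n → U n k) (λ n → S n k) (λ n → ties n k) (eventually-small-ties q)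
    (λ n → ℕ.≤-trans (U≤T+ties n k) (ℕ.+-monoˡ-≤ (ties n k) (T≤S n k)))
    (λ n → ℕ.≤-trans (S≤T+ties n k) (ℕ.+-monoˡ-≤ (ties n k) (T≤U n k)))
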